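{- For all integers $m > n \ge 3$, $$\gamma_c(G(n,m)) = \gamma_c(G(n,m-1)) + \frac12\left(1+(-1)^m\right).$$
   Context: For integers $n,m\ge 1$, the grid $G(n,m)$ has cell set $V_{n,m}=\{(i,j): 1\le i\le n,\ 1\le j\le m\}$ ($i$ = row, $j$ = column). Contamination rules: a cell $u=(i,j)\in V_{n,m}$ can be contaminated by two contaminated cells $v,w\in V_{n,m}$ if one of the following holds: (a) $v=(i-1,j-1)$, $w=(i+1,j+1)$; (b) $v=(i+1,j-1)$, $w=(i-1,j+1)$; (c) $v=(i-1,j)$, $w=(i+1,j)$; (d) $v=(i,j-1)$, $w=(i,j+1)$; (e) $v=(i,j-1)$, $w=(i-1,j)$; (f) $v=(i,j-1)$, $w=(i+1,j)$; (g) $v=(i+1,j)$, $w=(i,j+1)$; (h) $v=(i-1,j)$, $w=(i,j+1)$. For $S\subseteq V_{n,m}$, the final contaminated set $C(S)$ is the smallest subset of $V_{n,m}$ containing $S$ and closed under rules (a)--(h). $S$ is a contaminating set if $C(S)=V_{n,m}$. The power contamination number $\gamma_c(G(n,m))$ is the minimum cardinality of a contaminating set. -}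

module Defs where

open import Data.Fin using (Fin; toℕ; combine; remQuot)
open import Data.Fin.Properties using (any?; all?; remQuot-combine)
import Data.Fin.Properties as Fin
open import Data.Fin.Subset using (Subset; _∈_; _∪_; ⁅_⁆; ⊤; ∣_∣; _⊃_)
open import Data.Fin.Subset.Induction using (Acc; acc; ⊃-wellFounded)
open import Data.Fin.Subset.Properties
  using (_∈?_; ∈⊤; anySubset?; p⊆p∪q; q⊆p∪q; x∈⁅x⁆; x∈p∪q⁻; x∈⁅y⁆⇒x≡y)
open import Data.Nat using (ℕ; suc; _*_; _≤_; _<_)
open import Data.Nat.Induction using (<-wellFounded)
open import Data.Nat.Properties using (_≟_; _<?_; ≮⇒≥)
open import Data.Product using (Σ-syntax; ∃; ∃-syntax; _×_; _,_; proj₁; proj₂; uncurry)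
open import Data.Sum using (inj₁; inj₂)
open import Function using (_∘_)
open import Relation.Binary.PropositionalEquality using (_≡_; refl; sym; trans; cong; subst)
open import Relation.Nullary using (¬_; Dec; yes; no; ¬?; contradiction)
open import Relation.Nullary.Decidable using (map′; _×-dec_; _⊎-dec_)

infix 4 _⋖_ _⋖?_

_⋖_ : ∀ {k} → Fin k → Fin k → Set
i ⋖ i′ = toℕ i′ ≡ suc (toℕ i)

_⋖?_ : ∀ {k} (i i′ : Fin k) → Dec (i ⋖ i′)
i ⋖? i′ = toℕ i′ ≟ suc (toℕ i)

module Grid (n m : ℕ) where

  Cell : Set
  Cell = Fin n × Fin m

  -- A set of cells is a library Subset of the n * m positions, the cell (i , j)
  -- being identified with combine i j.
  CellSet : Set
  CellSet = Subset (n * m)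

  infix 4 _∈ᶜ_ _∈ᶜ?_

  _∈ᶜ_ : Cell → CellSet → Set
  (i , j) ∈ᶜ S = combine i j ∈ S

  -- Rule u v w : u can be contaminated by the contaminated cells v and w.
  -- The names i⁻, i⁺, j⁻, j⁺ stand for i - 1, i + 1, j - 1, j + 1.
  data Rule : (u v w : Cell) → Set where
    rule-a : ∀ {i⁻ i i⁺ : Fin n} {j⁻ j j⁺ : Fin m} → i⁻ ⋖ i → i ⋖ i⁺ → j⁻ ⋖ j → j ⋖ j⁺ →
             Rule (i , j) (i⁻ , j⁻) (i⁺ , j⁺)
    rule-b : ∀ {i⁻ i i⁺ : Fin n} {j⁻ j j⁺ : Fin m} → i⁻ ⋖ i → i ⋖ i⁺ → j⁻ ⋖ j → j ⋖ j⁺ →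
             Rule (i , j) (i⁺ , j⁻) (i⁻ , j⁺)
    rule-c : ∀ {i⁻ i i⁺ : Fin n} {j : Fin m} → i⁻ ⋖ i → i ⋖ i⁺ →
             Rule (i , j) (i⁻ , j) (i⁺ , j)
    rule-d : ∀ {i : Fin n} {j⁻ j j⁺ : Fin m} → j⁻ ⋖ j → j ⋖ j⁺ →
             Rule (i , j) (i , j⁻) (i , j⁺)
    rule-e : ∀ {i⁻ i : Fin n} {j⁻ j : Fin m} → j⁻ ⋖ j → i⁻ ⋖ i →
             Rule (i , j) (i , j⁻) (i⁻ , j)
    rule-f : ∀ {i i⁺ : Fin n} {j⁻ j : Fin m} → j⁻ ⋖ j → i ⋖ i⁺ →
             Rule (i , j) (i , j⁻) (i⁺ , j)
    rule-g : ∀ {i i⁺ : Fin n} {j j⁺ : Fin m} → i ⋖ i⁺ → j ⋖ j⁺ →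
             Rule (i , j) (i⁺ , j) (i , j⁺)
    rule-h : ∀ {i⁻ i : Fin n} {j j⁺ : Fin m} → i⁻ ⋖ i → j ⋖ j⁺ →
             Rule (i , j) (i⁻ , j) (i , j⁺)

  data C (S : CellSet) : Cell → Set where
    initial : ∀ {u} → u ∈ᶜ S → C S u
    spread  : ∀ {u v w} → Rule u v w → C S v → C S w → C S u

  Closed : (Cell → Set) → Set
  Closed P = ∀ {u v w} → Rule u v w → P v → P w → P u

  C-least : ∀ {S : CellSet} (P : Cell → Set) →
            (∀ {u} → u ∈ᶜ S → P u) → Closed P → ∀ {u} → C S u → P u
  C-least P base step (initial u∈S)  = base u∈S
  C-least P base step (spread r p q) =
    step r (C-least P base step p) (C-least P base step q)

  Contaminating : CellSet → Set
  Contaminating S = ∀ u → C S u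

  IsPowerContaminationNumber : ℕ → Set
  IsPowerContaminationNumber k =
    (Σ[ S ∈ CellSet ] Contaminating S × ∣ S ∣ ≡ k) ×
    (∀ (S : CellSet) → Contaminating S → k ≤ ∣ S ∣)

  -- The rest shows that being a contaminating set is decidable, so that the
  -- minimum exists constructively and γc is a function.

  _∈ᶜ?_ : (u : Cell) (S : CellSet) → Dec (u ∈ᶜ S)
  (i , j) ∈ᶜ? S = combine i j ∈? S

  rule? : (u v w : Cell) → Dec (Rule u v w)
  rule? (i , j) (k , l) (p , q) = map′
    (λ where
      (inj₁ (a , b , c , d)) → rule-a a b c d
      (inj₂ (inj₁ (a , b , c , d))) → rule-b a b c d
      (inj₂ (inj₂ (inj₁ (a , b , refl , refl)))) → rule-c a b
      (inj₂ (inj₂ (inj₂ (inj₁ (a , b , refl , refl))))) → rule-d a b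
      (inj₂ (inj₂ (inj₂ (inj₂ (inj₁ (a , b , refl , refl)))))) → rule-e a b
      (inj₂ (inj₂ (inj₂ (inj₂ (inj₂ (inj₁ (a , b , refl , refl))))))) → rule-f a b
      (inj₂ (inj₂ (inj₂ (inj₂ (inj₂ (inj₂ (inj₁ (a , b , refl , refl)))))))) → rule-g a b
      (inj₂ (inj₂ (inj₂ (inj₂ (inj₂ (inj₂ (inj₂ (a , b , refl , refl)))))))) → rule-h a b)
    (λ where
      (rule-a a b c d) → inj₁ (a , b , c , d)
      (rule-b a b c d) → inj₂ (inj₁ (a , b , c , d))
      (rule-c a b) → inj₂ (inj₂ (inj₁ (a , b , refl , refl)))
      (rule-d a b) → inj₂ (inj₂ (inj₂ (inj₁ (a , b , refl , refl))))
      (rule-e a b) → inj₂ (inj₂ (inj₂ (inj₂ (inj₁ (a , b , refl , refl)))))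
      (rule-f a b) → inj₂ (inj₂ (inj₂ (inj₂ (inj₂ (inj₁ (a , b , refl , refl))))))
      (rule-g a b) → inj₂ (inj₂ (inj₂ (inj₂ (inj₂ (inj₂ (inj₁ (a , b , refl , refl)))))))
      (rule-h a b) → inj₂ (inj₂ (inj₂ (inj₂ (inj₂ (inj₂ (inj₂ (a , b , refl , refl))))))))
    (    (k ⋖? i ×-dec i ⋖? p ×-dec l ⋖? j ×-dec j ⋖? q)
    ⊎-dec (p ⋖? i ×-dec i ⋖? k ×-dec l ⋖? j ×-dec j ⋖? q)
    ⊎-dec (k ⋖? i ×-dec i ⋖? p ×-dec l Fin.≟ j ×-dec q Fin.≟ j)
    ⊎-dec (l ⋖? j ×-dec j ⋖? q ×-dec k Fin.≟ i ×-dec p Fin.≟ i)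
    ⊎-dec (l ⋖? j ×-dec p ⋖? i ×-dec k Fin.≟ i ×-dec q Fin.≟ j)
    ⊎-dec (l ⋖? j ×-dec i ⋖? p ×-dec k Fin.≟ i ×-dec q Fin.≟ j)
    ⊎-dec (i ⋖? k ×-dec j ⋖? q ×-dec l Fin.≟ j ×-dec p Fin.≟ i)
    ⊎-dec (k ⋖? i ×-dec j ⋖? q ×-dec l Fin.≟ j ×-dec p Fin.≟ i))

  anyCell? : {P : Cell → Set} → (∀ u → Dec (P u)) → Dec (∃ P)
  anyCell? P? = map′ (λ (i , j , p) → (i , j) , p) (λ ((i , j) , p) → i , j , p)
    (any? λ i → any? λ j → P? (i , j))

  Violation : CellSet → Cell → Set
  Violation T u = (¬ u ∈ᶜ T) × ∃[ v ] ∃[ w ] (Rule u v w × v ∈ᶜ T × w ∈ᶜ T)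

  violation? : (T : CellSet) → ∀ u → Dec (Violation T u)
  violation? T u = ¬? (u ∈ᶜ? T) ×-dec
    anyCell? λ v → anyCell? λ w → rule? u v w ×-dec v ∈ᶜ? T ×-dec w ∈ᶜ? T

  combine-injective : ∀ {u v : Cell} → uncurry combine u ≡ uncurry combine v → u ≡ v
  combine-injective {i , j} {k , l} eq =
    trans (sym (remQuot-combine i j)) (trans (cong (remQuot m) eq) (remQuot-combine k l))

  closure : (S T : CellSet) → Acc _⊃_ T →
            (∀ {u} → u ∈ᶜ S → u ∈ᶜ T) → (∀ {u} → u ∈ᶜ T → C S u) →
            Σ[ T′ ∈ CellSet ] (∀ {u} → u ∈ᶜ S → u ∈ᶜ T′) × Closed (_∈ᶜ T′) ×
                                   (∀ {u} → u ∈ᶜ T′ → C S u)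
  closure S T (acc rec) S⊆T T⊆C with anyCell? (violation? T)
  ... | yes (u , u∉T , v , w , r , v∈T , w∈T) =
    closure S T⁺ (rec (p⊆p∪q _ , x , q⊆p∪q T _ (x∈⁅x⁆ x) , u∉T))
      (p⊆p∪q _ ∘ S⊆T) T⁺⊆C
    where
    x = uncurry combine u
    T⁺ = T ∪ ⁅ x ⁆
    T⁺⊆C : ∀ {u′} → u′ ∈ᶜ T⁺ → C S u′
    T⁺⊆C u′∈T⁺ with x∈p∪q⁻ T ⁅ x ⁆ u′∈T⁺
    ... | inj₁ u′∈T = T⊆C u′∈T
    ... | inj₂ u′∈x = subst (C S) (sym (combine-injective (x∈⁅y⁆⇒x≡y x u′∈x)))
                        (spread r (T⊆C v∈T) (T⊆C w∈T))
  ... | no none = T , S⊆T , closed , T⊆C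
    where
    closed : Closed (_∈ᶜ T)
    closed {u} {v} {w} r v∈T w∈T with u ∈ᶜ? T
    ... | yes u∈T = u∈T
    ... | no  u∉T = contradiction (u , u∉T , v , w , r , v∈T , w∈T) none

  C? : (S : CellSet) → ∀ u → Dec (C S u)
  C? S u with T , S⊆T , closed , T⊆C ← closure S S (⊃-wellFounded S) (λ p → p) initial =
    map′ T⊆C (C-least (_∈ᶜ T) S⊆T closed) (u ∈ᶜ? T)

  contaminating? : (S : CellSet) → Dec (Contaminating S)
  contaminating? S = map′ (λ f (i , j) → f i j) (λ f i j → f (i , j))
    (all? λ i → all? λ j → C? S (i , j))

  minimum : (S : CellSet) → Contaminating S → Acc _<_ ∣ S ∣ →
            ∃ IsPowerContaminationNumber
  minimum S cS (acc rec) with anySubset? (λ T → contaminating? T ×-dec ∣ T ∣ <? ∣ S ∣)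
  ... | yes (T , cT , T<S) = minimum T cT (rec T<S)
  ... | no none = ∣ S ∣ , (S , cS , refl) , λ T cT → ≮⇒≥ λ T<S → none (T , cT , T<S)

  minimum-exists : ∃ IsPowerContaminationNumber
  minimum-exists = minimum ⊤ (λ _ → initial ∈⊤) (<-wellFounded _)

  γc : ℕ
  γc = proj₁ minimum-exists

  γc-isPowerContaminationNumber : IsPowerContaminationNumber γc
  γc-isPowerContaminationNumber = proj₂ minimum-exists

open Grid public using (γc; γc-isPowerContaminationNumber)

{-# OPTIONS --safe #-}
module Submission where

-- For m ≥ n ≥ 3 the number γc n m equals 1 + ⌊ m /2⌋.
-- Lower bound: split the columns (counted from 0) into the blocks {0}, {1,2},
-- {3,4}, …; a block free of initially contaminated cells stays clean forever, so
-- a contaminating set meets each of the 1 + ⌊ m /2⌋ blocks.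
-- Upper bound: take the cells (min(2k, n-1) , min(2k, m-1)) for k ≤ ⌊ m /2⌋; the
-- first k + 1 of them contaminate the rectangle from (0 , 0) to the k-th one.

open import Defs
open import Data.Nat using (ℕ; _<_; _≤_; _∸_)
open import Data.Integer using (+_; -1ℤ; 1ℤ; _^_) renaming (_+_ to _+ℤ_)
open import Data.Rational using (_/_; ½; _+_; _*_)
open import Relation.Binary.PropositionalEquality using (_≡_)

open import Data.Bool using (true; false)
open import Data.Fin using (Fin; zero; suc; toℕ; fromℕ<; combine; inject₁)
open import Data.Fin.Properties
  using (toℕ<n; toℕ-fromℕ<; toℕ-inject₁; toℕ-injective; suc-injective; 0≢1+n)
open import Data.Fin.Subset using (Subset; _∈_; _∪_; ⁅_⁆; ∣_∣)
open import Data.Fin.Subset.Properties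
  using (x∈⁅x⁆; ∣⁅x⁆∣≡1; p⊆p∪q; q⊆p∪q; x∈p⇒∣p-x∣<∣p∣; x∈p∧x≢y⇒x∈p-y)
open import Data.Nat using (zero; suc; z≤n; s≤s; _⊓_; ⌊_/2⌋; ⌈_/2⌉)
import Data.Nat as ℕ
import Data.Nat.Properties as ℕ
open import Data.Integer using () renaming (_*_ to _*ℤ_)
import Data.Integer.Properties as ℤ
open import Data.Rational using (1ℚ; toℚᵘ)
import Data.Rational.Properties as ℚ
import Data.Rational.Unnormalised as ℚᵘ
import Data.Rational.Unnormalised.Properties as ℚᵘ
open import Data.Product using (∃; ∃₂; _×_; _,_; proj₁; proj₂; uncurry)
open import Data.Sum using (_⊎_; inj₁; inj₂)
import Data.Sum as Sum
open import Data.Vec using ([]; _∷_)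
open import Function using (_∘_; Injective)
open import Relation.Binary.PropositionalEquality
  using (_≢_; refl; sym; trans; cong; subst; subst₂; module ≡-Reasoning)
open import Relation.Nullary using (yes; no; contradiction)
open import Relation.Nullary.Decidable using (_×-dec_)

-- Cardinalities of finite subsets.

∣p∪q∣≤∣p∣+∣q∣ : ∀ {n} (p q : Subset n) → ∣ p ∪ q ∣ ≤ ∣ p ∣ ℕ.+ ∣ q ∣
∣p∪q∣≤∣p∣+∣q∣ []          []          = z≤n
∣p∪q∣≤∣p∣+∣q∣ (false ∷ p) (false ∷ q) = ∣p∪q∣≤∣p∣+∣q∣ p q
∣p∪q∣≤∣p∣+∣q∣ (false ∷ p) (true  ∷ q) =
  ℕ.≤-trans (s≤s (∣p∪q∣≤∣p∣+∣q∣ p q)) (ℕ.≤-reflexive (sym (ℕ.+-suc ∣ p ∣ ∣ q ∣)))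
∣p∪q∣≤∣p∣+∣q∣ (true  ∷ p) (false ∷ q) = s≤s (∣p∪q∣≤∣p∣+∣q∣ p q)
∣p∪q∣≤∣p∣+∣q∣ (true  ∷ p) (true  ∷ q) =
  s≤s (ℕ.≤-trans (∣p∪q∣≤∣p∣+∣q∣ p q) (ℕ.+-monoʳ-≤ ∣ p ∣ (ℕ.n≤1+n _)))

-- Deleting `f zero` from `p` lowers the cardinality and, by injectivity, keeps all the other
-- values.
injective⇒≤∣p∣ : ∀ {n} k {p : Subset n} (f : Fin k → Fin n) → Injective _≡_ _≡_ f →
                 (∀ i → f i ∈ p) → k ≤ ∣ p ∣
injective⇒≤∣p∣ zero    f inj f∈p = z≤n
injective⇒≤∣p∣ (suc k) f inj f∈p = ℕ.≤-<-trans
  (injective⇒≤∣p∣ k (f ∘ suc) (suc-injective ∘ inj)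
    λ i → x∈p∧x≢y⇒x∈p-y (f∈p (suc i)) λ eq → 0≢1+n (sym (inj eq)))
  (x∈p⇒∣p-x∣<∣p∣ (f∈p zero))

-- Halving, clamped indices and column blocks.

⌈k*2/2⌉≡k : ∀ k → ⌈ k ℕ.* 2 /2⌉ ≡ k
⌈k*2/2⌉≡k zero    = refl
⌈k*2/2⌉≡k (suc k) = cong suc (⌈k*2/2⌉≡k k)

n≤⌈n/2⌉*2 : ∀ n → n ≤ ⌈ n /2⌉ ℕ.* 2
n≤⌈n/2⌉*2 zero          = z≤n
n≤⌈n/2⌉*2 (suc zero)    = s≤s z≤n
n≤⌈n/2⌉*2 (suc (suc n)) = s≤s (s≤s (n≤⌈n/2⌉*2 n))

-- Column `1 + n` is not column 0, so it lies in a pair {2k-1, 2k}, and its partner is an adjacent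
-- column.
⌈1+n/2⌉-neighbour : ∀ n → ⌈ 1 ℕ.+ n /2⌉ ≡ ⌈ n /2⌉ ⊎ ⌈ 1 ℕ.+ n /2⌉ ≡ ⌈ 2 ℕ.+ n /2⌉
⌈1+n/2⌉-neighbour zero          = inj₂ refl
⌈1+n/2⌉-neighbour (suc zero)    = inj₁ refl
⌈1+n/2⌉-neighbour (suc (suc n)) = Sum.map (cong suc) (cong suc) (⌈1+n/2⌉-neighbour n)

clamp : ℕ → (N : ℕ) → Fin (suc N)
clamp c N = fromℕ< (s≤s (ℕ.m⊓n≤n c N))

toℕ-clamp : ∀ c N → toℕ (clamp c N) ≡ c ⊓ N
toℕ-clamp c N = toℕ-fromℕ< (s≤s (ℕ.m⊓n≤n c N))

-- Rounding up isolates column 0; the pairs {0,1}, {2,3}, ... would give one block fewer when the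
-- number of columns is even.
block : ∀ {m} → Fin m → ℕ
block j = ⌈ toℕ j /2⌉

block-between : ∀ {m} {j⁻ j j⁺ : Fin m} → j⁻ ⋖ j → j ⋖ j⁺ →
                block j ≡ block j⁻ ⊎ block j ≡ block j⁺
block-between {j⁻ = j⁻} p q rewrite q | p = ⌈1+n/2⌉-neighbour (toℕ j⁻)

-- Shows that no block is empty. The clamp matters for odd `M`, where the last block is column `M`
-- alone and 2k overshoots it by one.
block-clamp : ∀ {k M} → k ≤ ⌈ M /2⌉ → block (clamp (k ℕ.* 2) M) ≡ k
block-clamp {k} {M} k≤ = begin
  block (clamp (k ℕ.* 2) M)      ≡⟨ cong ⌈_/2⌉ (toℕ-clamp (k ℕ.* 2) M) ⟩
  ⌈ k ℕ.* 2 ⊓ M /2⌉              ≡⟨ ℕ.mono-≤-distrib-⊓ ℕ.⌈n/2⌉-mono (k ℕ.* 2) M ⟩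
  ⌈ k ℕ.* 2 /2⌉ ⊓ ⌈ M /2⌉        ≡⟨ cong (_⊓ ⌈ M /2⌉) (⌈k*2/2⌉≡k k) ⟩
  k ⊓ ⌈ M /2⌉                    ≡⟨ ℕ.m≤n⇒m⊓n≡m k≤ ⟩
  k                              ∎
  where open ≡-Reasoning

≢-between : ∀ {x y z k : ℕ} → x ≡ y ⊎ x ≡ z → y ≢ k → z ≢ k → x ≢ k
≢-between (inj₁ refl) y≢k z≢k = y≢k
≢-between (inj₂ refl) y≢k z≢k = z≢k

-- Lower bound: every block is met.

module _ {N M : ℕ} where
  open Grid (suc N) (suc M)

  -- In every rule some source lies in the target's block: for (a), (b), (d) the sources occupy both
  -- adjacent columns, and otherwise one source is in the target's own column.
  clean-block-closed : ∀ k → Closed (λ (_ , j) → block j ≢ k)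
  clean-block-closed k r p q eq with r
  ... | rule-a _ _ j⁻⋖j j⋖j⁺ = ≢-between (block-between j⁻⋖j j⋖j⁺) p q eq
  ... | rule-b _ _ j⁻⋖j j⋖j⁺ = ≢-between (block-between j⁻⋖j j⋖j⁺) p q eq
  ... | rule-c _ _           = p eq
  ... | rule-d j⁻⋖j j⋖j⁺     = ≢-between (block-between j⁻⋖j j⋖j⁺) p q eq
  ... | rule-e _ _           = q eq
  ... | rule-f _ _           = q eq
  ... | rule-g _ _           = p eq
  ... | rule-h _ _           = p eq

  meets-block : ∀ {S} → Contaminating S → ∀ {k} → k ≤ ⌈ M /2⌉ →
                ∃ λ u → u ∈ᶜ S × block (proj₂ u) ≡ k
  meets-block {S} cS {k} k≤
    with anyCell? (λ u → u ∈ᶜ? S ×-dec block (proj₂ u) ℕ.≟ k)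
  ... | yes found = found
  -- If `S` avoids block k, minimality of the closure keeps that block clean, yet a cell of it is
  -- contaminated.
  ... | no none = contradiction (block-clamp k≤)
    (C-least (λ (_ , j) → block j ≢ k) (λ {u} u∈S eq → none (u , u∈S , eq))
      (clean-block-closed k) (cS (zero , clamp (k ℕ.* 2) M)))

  transversal⇒∣S∣>⌈M/2⌉ :
    ∀ S → (∀ (k : Fin (suc ⌈ M /2⌉)) → ∃ λ u → u ∈ᶜ S × block (proj₂ u) ≡ toℕ k) →
    ⌈ M /2⌉ < ∣ S ∣
  transversal⇒∣S∣>⌈M/2⌉ S hit =
    injective⇒≤∣p∣ _ (uncurry combine ∘ cell) injective (proj₁ ∘ proj₂ ∘ hit)
    where
    cell : Fin (suc ⌈ M /2⌉) → Cell
    cell = proj₁ ∘ hit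
    injective : Injective _≡_ _≡_ (uncurry combine ∘ cell)
    injective {k} {l} eq = toℕ-injective (trans (sym (proj₂ (proj₂ (hit k))))
      (trans (cong (block ∘ proj₂) (combine-injective {cell k} {cell l} eq))
        (proj₂ (proj₂ (hit l)))))

  contaminating⇒∣S∣>⌈M/2⌉ : ∀ S → Contaminating S → ⌈ M /2⌉ < ∣ S ∣
  contaminating⇒∣S∣>⌈M/2⌉ S cS =
    transversal⇒∣S∣>⌈M/2⌉ S λ k → meets-block cS (ℕ.≤-pred (toℕ<n k))

-- Growing a contaminated rectangle.

predecessor : ∀ {k x} (i⁺ : Fin k) → toℕ i⁺ ≡ suc x → ∃ λ (i : Fin k) → toℕ i ≡ x
predecessor (suc i) refl = inject₁ i , toℕ-inject₁ i

⋖-intro : ∀ {k x} {i i⁺ : Fin k} → toℕ i ≡ x → toℕ i⁺ ≡ suc x → i ⋖ i⁺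
⋖-intro refl eq = eq

module Growth (n m : ℕ) (S : Grid.CellSet n m) where
  open Grid n m

  -- Coordinates are plain numbers and membership in the grid is part of the claim, so no bounds
  -- need to be carried along.
  Filled : ℕ → ℕ → Set
  Filled x y = ∃₂ λ i j → toℕ i ≡ x × toℕ j ≡ y × C S (i , j)

  fill-a : ∀ {x y} → Filled x y → Filled (2 ℕ.+ x) (2 ℕ.+ y) → Filled (suc x) (suc y)
  fill-a (i⁻ , j⁻ , i⁻≡ , j⁻≡ , p) (i⁺ , j⁺ , i⁺≡ , j⁺≡ , q)
    with i , i≡ ← predecessor i⁺ i⁺≡ | j , j≡ ← predecessor j⁺ j⁺≡ =
    i , j , i≡ , j≡ ,
    spread (rule-a (⋖-intro i⁻≡ i≡) (⋖-intro i≡ i⁺≡) (⋖-intro j⁻≡ j≡) (⋖-intro j≡ j⁺≡)) p q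

  fill-d : ∀ {x y} → Filled x y → Filled x (2 ℕ.+ y) → Filled x (suc y)
  fill-d (i , j⁻ , i≡ , j⁻≡ , p) (i′ , j⁺ , i′≡ , j⁺≡ , q)
    with refl ← toℕ-injective (trans i≡ (sym i′≡)) | j , j≡ ← predecessor j⁺ j⁺≡ =
    i , j , i≡ , j≡ , spread (rule-d (⋖-intro j⁻≡ j≡) (⋖-intro j≡ j⁺≡)) p q

  fill-f : ∀ {x y} → Filled x y → Filled (suc x) (suc y) → Filled x (suc y)
  fill-f (i , j⁻ , i≡ , j⁻≡ , p) (i⁺ , j , i⁺≡ , j≡ , q) =
    i , j , i≡ , j≡ , spread (rule-f (⋖-intro j⁻≡ j≡) (⋖-intro i≡ i⁺≡)) p q

  fill-h : ∀ {x y} → Filled x y → Filled (suc x) (suc y) → Filled (suc x) y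
  fill-h (i⁻ , j , i⁻≡ , j≡ , p) (i , j⁺ , i≡ , j⁺≡ , q) =
    i , j , i≡ , j≡ , spread (rule-h (⋖-intro i⁻≡ i≡) (⋖-intro j≡ j⁺≡)) p q

  Box : ℕ → ℕ → Set
  Box a b = ∀ {x y} → x ≤ a → y ≤ b → Filled x y

  corner : ∀ {a b} → Box a b → Filled a b
  corner box = box ℕ.≤-refl ℕ.≤-refl

  -- Rule (f) climbs the new column from its bottom cell, using the left neighbour and the cell
  -- below.
  fill-column : ∀ {a y} → (∀ {x} → x ≤ a → Filled x y) → Filled a (suc y) →
                ∀ {x} → x ≤ a → Filled x (suc y)
  fill-column {zero}  left p z≤n = p
  fill-column {suc a} left p x≤1+a with ℕ.m≤n⇒m<n∨m≡n x≤1+a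
  ... | inj₂ refl      = p
  ... | inj₁ (s≤s x≤a) =
    fill-column (left ∘ ℕ.m≤n⇒m≤1+n) (fill-f (left (ℕ.n≤1+n a)) p) x≤a

  -- Rule (h) runs leftwards along the new row from its right end, using the cells above and to the
  -- right.
  fill-row : ∀ {x b} → (∀ {y} → y ≤ b → Filled x y) → Filled (suc x) b →
             ∀ {y} → y ≤ b → Filled (suc x) y
  fill-row {b = zero}  above p z≤n = p
  fill-row {b = suc b} above p y≤1+b with ℕ.m≤n⇒m<n∨m≡n y≤1+b
  ... | inj₂ refl      = p
  ... | inj₁ (s≤s y≤b) =
    fill-row (above ∘ ℕ.m≤n⇒m≤1+n) (fill-h (above (ℕ.n≤1+n b)) p) y≤b

  add-column : ∀ {a b} → Box a b → Filled a (suc b) → Box a (suc b)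
  add-column box p x≤a y≤1+b with ℕ.m≤n⇒m<n∨m≡n y≤1+b
  ... | inj₁ (s≤s y≤b) = box x≤a y≤b
  ... | inj₂ refl      = fill-column (λ x≤ → box x≤ ℕ.≤-refl) p x≤a

  add-row : ∀ {a b} → Box a b → Filled (suc a) b → Box (suc a) b
  add-row box p x≤1+a y≤b with ℕ.m≤n⇒m<n∨m≡n x≤1+a
  ... | inj₁ (s≤s x≤a) = box x≤a y≤b
  ... | inj₂ refl      = fill-row (box ℕ.≤-refl) p y≤b

  -- The cell diagonally beyond the corner yields its upper neighbour by (f), which starts the new
  -- column; the cell itself then starts the new row.
  add-both : ∀ {a b} → Box a b → Filled (suc a) (suc b) → Box (suc a) (suc b)
  add-both box p = add-row (add-column box (fill-f (corner box) p)) p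

  add-two-both : ∀ {a b} → Box a b → Filled (2 ℕ.+ a) (2 ℕ.+ b) → Box (2 ℕ.+ a) (2 ℕ.+ b)
  add-two-both box p = add-both (add-both box (fill-a (corner box) p)) p

-- Moves of the clamped corner.

data Step (a : ℕ) : ℕ → Set where
  +0 : Step a a
  +1 : Step a (1 ℕ.+ a)
  +2 : Step a (2 ℕ.+ a)

-- With `N ≤ M` the row index is clamped no later than the column index, so it never advances
-- further than the column index does.
data Advance (a b : ℕ) : ℕ → ℕ → Set where
  +0,_  : ∀ {b′} → Step b b′ → Advance a b a b′
  +1,+1 : Advance a b (1 ℕ.+ a) (1 ℕ.+ b)
  +1,+2 : Advance a b (1 ℕ.+ a) (2 ℕ.+ b)
  +2,+2 : Advance a b (2 ℕ.+ a) (2 ℕ.+ b)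

step-suc : ∀ {a a′} → Step a a′ → Step (suc a) (suc a′)
step-suc +0 = +0
step-suc +1 = +1
step-suc +2 = +2

advance-suc : ∀ {a b a′ b′} → Advance a b a′ b′ → Advance (suc a) (suc b) (suc a′) (suc b′)
advance-suc (+0, s) = +0, step-suc s
advance-suc +1,+1   = +1,+1
advance-suc +1,+2   = +1,+2
advance-suc +2,+2   = +2,+2

clamped-step : ∀ c M → Step (c ⊓ M) ((2 ℕ.+ c) ⊓ M)
clamped-step zero    zero          = +0
clamped-step zero    (suc zero)    = +1
clamped-step zero    (suc (suc M)) = +2
clamped-step (suc c) zero          = +0
clamped-step (suc c) (suc M)       = step-suc (clamped-step c M)

clamped-advance : ∀ c {N M} → N ≤ M →
                  Advance (c ⊓ N) (c ⊓ M) ((2 ℕ.+ c) ⊓ N) ((2 ℕ.+ c) ⊓ M)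
clamped-advance zero    {M = M} z≤n             = +0, clamped-step zero M
clamped-advance (suc c) {M = M} z≤n             = +0, clamped-step (suc c) M
clamped-advance zero    (s≤s (z≤n {zero}))      = +1,+1
clamped-advance zero    (s≤s (z≤n {suc M}))     = +1,+2
clamped-advance zero    (s≤s (s≤s _))           = +2,+2
clamped-advance (suc c) (s≤s N≤M)               = advance-suc (clamped-advance c N≤M)

module _ {n m : ℕ} {S : Grid.CellSet n m} where
  open Growth n m S

  grow : ∀ {a b a′ b′} → Advance a b a′ b′ → Box (suc a) (suc b) →
         Filled (suc a′) (suc b′) → Box (suc a′) (suc b′)
  grow (+0, +0) box p = box
  grow (+0, +1) box p = add-column box p
  -- The seed is two columns right of the corner in the same row; rule (d) fills the gap.
  grow (+0, +2) box p = add-column (add-column box (fill-d (corner box) p)) p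
  grow +1,+1    box p = add-both box p
  -- Rule (a) needs the corner's upper neighbour, hence a box with at least two
  -- rows; this is where n ≥ 3 is used.
  grow +1,+2    box p = add-both
    (add-column box (fill-a (box (ℕ.n≤1+n _) ℕ.≤-refl) p)) p
  grow +2,+2    box p = add-two-both box p

-- Upper bound: the seeds contaminate the grid.

module Seeds (N M : ℕ) where
  open Grid (suc N) (suc M)

  seed : ℕ → Cell
  seed k = clamp (k ℕ.* 2) N , clamp (k ℕ.* 2) M

  seeds : ℕ → CellSet
  seeds zero    = ⁅ uncurry combine (seed 0) ⁆
  seeds (suc k) = seeds k ∪ ⁅ uncurry combine (seed (suc k)) ⁆

  ∣seeds∣≤ : ∀ k → ∣ seeds k ∣ ≤ suc k
  ∣seeds∣≤ zero    = ℕ.≤-reflexive (∣⁅x⁆∣≡1 (uncurry combine (seed 0)))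
  ∣seeds∣≤ (suc k) = begin
    ∣ seeds k ∪ ⁅ x ⁆ ∣        ≤⟨ ∣p∪q∣≤∣p∣+∣q∣ (seeds k) ⁅ x ⁆ ⟩
    ∣ seeds k ∣ ℕ.+ ∣ ⁅ x ⁆ ∣  ≤⟨ ℕ.+-mono-≤ (∣seeds∣≤ k) (ℕ.≤-reflexive (∣⁅x⁆∣≡1 x)) ⟩
    suc k ℕ.+ 1                ≡⟨ ℕ.+-comm (suc k) 1 ⟩
    suc (suc k)                ∎
    where
    open ℕ.≤-Reasoning
    x = uncurry combine (seed (suc k))

  seed∈seeds : ∀ {k K} → k ≤ K → seed k ∈ᶜ seeds K
  seed∈seeds {K = zero}  z≤n = x∈⁅x⁆ _
  seed∈seeds {K = suc K} k≤1+K with ℕ.m≤n⇒m<n∨m≡n k≤1+K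
  ... | inj₁ (s≤s k≤K) = p⊆p∪q _ (seed∈seeds k≤K)
  ... | inj₂ refl      = q⊆p∪q (seeds K) _ (x∈⁅x⁆ _)

module _ {N M : ℕ} (2≤N : 2 ≤ N) (N≤M : N ≤ M) (K : ℕ) where
  open Grid (suc N) (suc M)
  open Seeds N M
  open Growth (suc N) (suc M) (seeds K)

  seed-filled : ∀ {k} → k ≤ K → Filled (k ℕ.* 2 ⊓ N) (k ℕ.* 2 ⊓ M)
  seed-filled k≤K = _ , _ , toℕ-clamp _ N , toℕ-clamp _ M , initial (seed∈seeds k≤K)

  seeds-box : ∀ k → k ≤ K → Box (k ℕ.* 2 ⊓ N) (k ℕ.* 2 ⊓ M)
  seeds-box zero          0≤K z≤n z≤n = seed-filled 0≤K
  -- The initial box is a single cell, too small for `grow`; as `2 ≤ N`, the second seed is (2 , 2)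
  -- and the move is two steps both ways.
  seeds-box (suc zero)    1≤K = first-growth 2≤N N≤M (seeds-box 0 z≤n) (seed-filled 1≤K)
    where
    first-growth : ∀ {N M} → 2 ≤ N → N ≤ M → Box 0 0 → Filled (2 ⊓ N) (2 ⊓ M) →
                   Box (2 ⊓ N) (2 ⊓ M)
    first-growth (s≤s (s≤s _)) (s≤s (s≤s _)) = add-two-both
  seeds-box (suc (suc k)) k≤K =
    next-growth 2≤N N≤M (seeds-box (suc k) (ℕ.<⇒≤ k≤K)) (seed-filled k≤K)
    where
    next-growth : ∀ {N M c} → 2 ≤ N → N ≤ M → Box ((2 ℕ.+ c) ⊓ N) ((2 ℕ.+ c) ⊓ M) →
                  Filled ((4 ℕ.+ c) ⊓ N) ((4 ℕ.+ c) ⊓ M) → Box ((4 ℕ.+ c) ⊓ N) ((4 ℕ.+ c) ⊓ M)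
    -- Lowering `c`, `N` and `M` by one exposes the `suc` in the corner's coordinates that `grow`
    -- expects.
    next-growth {c = c} (s≤s _) (s≤s N≤M) = grow (clamped-advance (suc c) N≤M)

  -- As `N ≤ M ≤ 2K`, both coordinates of the last seed are clamped to their maxima, so its box is
  -- the whole grid.
  seeds-contaminating : M ≤ K ℕ.* 2 → Contaminating (seeds K)
  seeds-contaminating M≤2K (i , j)
    with i′ , j′ , i′≡ , j′≡ , p ← seeds-box K ℕ.≤-refl
           (ℕ.⊓-glb (ℕ.≤-trans (ℕ.≤-pred (toℕ<n i)) (ℕ.≤-trans N≤M M≤2K)) (ℕ.≤-pred (toℕ<n i)))
           (ℕ.⊓-glb (ℕ.≤-trans (ℕ.≤-pred (toℕ<n j)) M≤2K) (ℕ.≤-pred (toℕ<n j)))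
    = subst₂ (λ i j → C (seeds K) (i , j)) (toℕ-injective i′≡) (toℕ-injective j′≡) p

-- The exact value.

powerContaminationNumber≡1+⌊m/2⌋ : ∀ {n m k} → 3 ≤ n → n ≤ m →
  Grid.IsPowerContaminationNumber n m k → k ≡ suc ⌊ m /2⌋
powerContaminationNumber≡1+⌊m/2⌋ {suc N} {suc M} (s≤s 2≤N) (s≤s N≤M) ((S , cS , refl) , least) =
  ℕ.≤-antisym
    (ℕ.≤-trans (least (seeds K) (seeds-contaminating 2≤N N≤M K (n≤⌈n/2⌉*2 M))) (∣seeds∣≤ K))
    (contaminating⇒∣S∣>⌈M/2⌉ S cS)
  where
  open Seeds N M
  -- With `m = suc M` this is `⌊ m /2⌋` by definition.
  K = ⌈ M /2⌉

γc≡1+⌊m/2⌋ : ∀ {n m} → 3 ≤ n → n ≤ m → γc n m ≡ suc ⌊ m /2⌋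
γc≡1+⌊m/2⌋ {n} {m} 3≤n n≤m =
  powerContaminationNumber≡1+⌊m/2⌋ 3≤n n≤m (γc-isPowerContaminationNumber n m)

-- Parity and the recurrence over the rationals.

parity : ∀ m → (-1ℤ ^ suc m ≡ 1ℤ × ⌊ suc m /2⌋ ≡ suc ⌊ m /2⌋) ⊎
               (-1ℤ ^ suc m ≡ -1ℤ × ⌊ suc m /2⌋ ≡ ⌊ m /2⌋)
parity zero          = inj₂ (refl , refl)
parity (suc zero)    = inj₁ (refl , refl)
parity (suc (suc m)) = Sum.map two-more two-more (parity m)
  where
  -- For `z` equal to `1ℤ` or `-1ℤ` the double product computes back to `z`.
  two-more : ∀ {z} {a b : ℕ} → -1ℤ ^ suc m ≡ z × a ≡ b →
             -1ℤ ^ suc (suc (suc m)) ≡ -1ℤ *ℤ (-1ℤ *ℤ z) × suc a ≡ suc b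
  two-more (z≡ , a≡b) = cong (λ z → -1ℤ *ℤ (-1ℤ *ℤ z)) z≡ , cong ℕ.suc a≡b

-- Normalisation in `/` blocks computation for a variable `n`, so the equation is checked on
-- unnormalised fractions.
1+n/1≡n/1+1 : ∀ n → + suc n / 1 ≡ + n / 1 + 1ℚ
1+n/1≡n/1+1 n = ℚ.toℚᵘ-injective (begin
  toℚᵘ (+ suc n / 1)              ≈⟨ ℚ.toℚᵘ-fromℚᵘ (ℚᵘ.mkℚᵘ (+ suc n) 0) ⟩
  ℚᵘ.mkℚᵘ (+ suc n) 0             ≈⟨ ℚᵘ.*≡* (cong (_*ℤ 1ℤ) 1+n≡n*1+1) ⟩
  ℚᵘ.mkℚᵘ (+ n) 0 ℚᵘ.+ ℚᵘ.1ℚᵘ     ≈⟨ ℚᵘ.+-congˡ ℚᵘ.1ℚᵘ (ℚ.toℚᵘ-fromℚᵘ (ℚᵘ.mkℚᵘ (+ n) 0)) ⟨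
  toℚᵘ (+ n / 1) ℚᵘ.+ ℚᵘ.1ℚᵘ      ≈⟨ ℚ.toℚᵘ-homo-+ (+ n / 1) 1ℚ ⟨
  toℚᵘ (+ n / 1 + 1ℚ)             ∎)
  where
  open ℚᵘ.≃-Reasoning
  1+n≡n*1+1 : + suc n ≡ + n *ℤ 1ℤ +ℤ 1ℤ
  1+n≡n*1+1 = trans (cong +_ (ℕ.+-comm 1 n)) (cong (_+ℤ 1ℤ) (sym (ℤ.*-identityʳ (+ n))))

1+⌊1+m/2⌋ : ∀ m → + suc ⌊ suc m /2⌋ / 1 ≡
                  + suc ⌊ m /2⌋ / 1 + ½ * ((1ℤ +ℤ (-1ℤ) ^ suc m) / 1)
1+⌊1+m/2⌋ m with parity m
-- The correction term computes to 1 for even `suc m` and to 0 for odd.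
... | inj₁ (sign , half) rewrite sign | half = 1+n/1≡n/1+1 (suc ⌊ m /2⌋)
... | inj₂ (sign , half) rewrite sign | half = sym (ℚ.+-identityʳ (+ suc ⌊ m /2⌋ / 1))

corollary3 : ∀ (n m : ℕ) → 3 ≤ n → n < m →
    (+ γc n m) / 1 ≡ (+ γc n (m ∸ 1)) / 1 + ½ * ((1ℤ +ℤ (-1ℤ) ^ m) / 1)
corollary3 n (suc m) 3≤n n<m@(s≤s n≤m) =
  -- Here `m` is one less than the number of columns; `n < suc m` gives `n ≤ m`, so the formula
  -- covers both grids.
  subst₂ (λ a b → + a / 1 ≡ + b / 1 + ½ * ((1ℤ +ℤ (-1ℤ) ^ suc m) / 1))
    (sym (γc≡1+⌊m/2⌋ 3≤n (ℕ.<⇒≤ n<m))) (sym (γc≡1+⌊m/2⌋ 3≤n n≤m)) (1+⌊1+m/2⌋ m)
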